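{- Let $G$ be a simple graph. Then the maximum order of a connected component of $G$ equals $c:=\deg\bigl(da(G;x,1)\bigr)$ (degree as a polynomial in $x$). Further, the number of components of $G$ of this maximum order $c$ is $[x^{c}]\,da(G;x,1)$.
   Context: All graphs are finite, simple and have at least one vertex. For a graph $G$, $S\subseteq V(G)$ and $u\in V(G)$, let $\bar S=V(G)\setminus S$, let $\delta_S(u)=|\{v\in S:\{u,v\}\in E(G)\}|$, and let $G[S]$ be the subgraph induced by $S$. The defensive alliance polynomial of $G$ is $$da(G;x,y)=\sum_{S} x^{|S|}\,y^{f_y(S)},\qquad f_y(S)=\min_{u\in S}\bigl(\delta_S(u)-\delta_{\bar S}(u)+|V(G)|\bigr),$$ where the sum runs over all non-empty $S\subseteq V(G)$ such that $G[S]$ is connected (single-vertex graphs are connected). $[x^k]\,da(G;x,1)$ denotes the coefficient of $x^k$ in $da(G;x,1)$. -}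

module Defs where

open import Data.Fin using (Fin)
import Data.Fin.Properties as Fin
open import Data.Fin.Subset using (Subset; inside; outside; _∈_; _⊆_; _∩_; ∁; ∣_∣; Nonempty)
open import Data.Fin.Subset.Properties using (_∈?_; _⊆?_; nonempty?; anySubset?; ∣p∣≤n)
import Data.Integer as ℤ
import Data.Integer.Properties as ℤ
open import Data.List using (List; []; _∷_; [_]; _++_; map; foldr; filter; length; replicate; upTo; allFin; alignWith)
open import Data.List.Membership.Propositional renaming (_∈_ to _∈ˡ_) using ()
open import Data.List.Membership.Propositional.Properties using (∈-allFin)
open import Data.List.Relation.Unary.Any using (here; there)
open import Data.Nat using (ℕ; zero; suc; _+_; _*_; _∸_; _≤_; _≟_)
open import Data.Nat.Properties using (≤-totalOrder; ≤-trans; m≤n+m)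
open import Data.List.Extrema ≤-totalOrder using (min; max)
open import Data.Product using (_×_; _,_; proj₁; proj₂; ∃-syntax)
open import Data.Sum using (_⊎_; inj₁; inj₂; fromInj₁)
open import Data.These using (mergeThese)
open import Data.Vec using ([]; _∷_; tabulate)
open import Level using (0ℓ)
open import Relation.Binary using (Rel; Decidable; Symmetric; Irreflexive)
open import Relation.Binary.Construct.Closure.ReflexiveTransitive using (Star; ε; _◅_; _◅◅_)
open import Relation.Binary.PropositionalEquality using (_≡_; refl; cong; module ≡-Reasoning)
open import Relation.Nullary using (Dec; does; ¬_; ¬?; _×-dec_; _⊎-dec_; _→-dec_)
open import Relation.Nullary.Decidable using (map′; decidable-stable)

record SimpleGraph (n : ℕ) : Set₁ where
  field
    Adj    : Rel (Fin n) 0ℓ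
    adj?   : Decidable Adj
    sym    : Symmetric Adj
    irrefl : Irreflexive _≡_ Adj

subsets : ∀ n → List (Subset n)
subsets zero    = [ [] ]
subsets (suc n) = map (inside ∷_) (subsets n) ++ map (outside ∷_) (subsets n)

-- Star R is decidable for a decidable R on Fin n, by Warshall's algorithm:
-- Via ws u v says that v is reachable from u with intermediate vertices in ws.
module Reachability {n} {R : Rel (Fin n) 0ℓ} (R? : Decidable R) where

  Via : List (Fin n) → Rel (Fin n) 0ℓ
  Via []       u v = u ≡ v ⊎ R u v
  Via (w ∷ ws) u v = Via ws u v ⊎ (Via ws u w × Via ws w v)

  via? : ∀ ws → Decidable (Via ws)
  via? []       u v = (u Fin.≟ v) ⊎-dec R? u v
  via? (w ∷ ws) u v = via? ws u v ⊎-dec (via? ws u w ×-dec via? ws w v)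

  via-base : ∀ ws {u v} → u ≡ v ⊎ R u v → Via ws u v
  via-base []       p = p
  via-base (w ∷ ws) p = inj₁ (via-base ws p)

  via⇒star : ∀ ws {u v} → Via ws u v → Star R u v
  via⇒star []       (inj₁ refl)    = ε
  via⇒star []       (inj₂ r)       = r ◅ ε
  via⇒star (w ∷ ws) (inj₁ p)       = via⇒star ws p
  via⇒star (w ∷ ws) (inj₂ (p , q)) = via⇒star ws p ◅◅ via⇒star ws q

  via-trans : ∀ {ws u x v} → x ∈ˡ ws → Via ws u x → Via ws x v → Via ws u v
  via-trans (here refl) p q = inj₂ (fromInj₁ proj₁ p , fromInj₁ proj₂ q)
  via-trans (there x∈) (inj₁ p)       (inj₁ q)       = inj₁ (via-trans x∈ p q)
  via-trans (there x∈) (inj₁ p)       (inj₂ (q , r)) = inj₂ (via-trans x∈ p q , r)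
  via-trans (there x∈) (inj₂ (o , p)) (inj₁ q)       = inj₂ (o , via-trans x∈ p q)
  via-trans (there x∈) (inj₂ (o , _)) (inj₂ (_ , r)) = inj₂ (o , r)

  star⇒via : ∀ {u v} → Star R u v → Via (allFin n) u v
  star⇒via ε        = via-base (allFin n) (inj₁ refl)
  star⇒via (r ◅ rs) = via-trans (∈-allFin _) (via-base (allFin n) (inj₂ r)) (star⇒via rs)

  star? : Decidable (Star R)
  star? u v = map′ (via⇒star (allFin n)) star⇒via (via? (allFin n) u v)

-- Polynomials in one variable over A, as lists of coefficients in ascending
-- order; trailing zeros are allowed.
Poly : Set → Set
Poly A = List A

add : ∀ {A} → (A → A → A) → Poly A → Poly A → Poly A
add _⊕_ = alignWith (mergeThese _⊕_)

monomial : ∀ {A : Set} → (0# a : A) → ℕ → Poly A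
monomial 0# a k = replicate k 0# ++ [ a ]

ℕ[X] : Set
ℕ[X] = Poly ℕ

coeff : ℕ[X] → ℕ → ℕ
coeff []      _       = 0
coeff (a ∷ p) zero    = a
coeff (a ∷ p) (suc k) = coeff p k

-- The zero polynomial gets degree 0.
deg : ℕ[X] → ℕ
deg p = max 0 (filter (λ k → ¬? (coeff p k ≟ 0)) (upTo (length p)))

eval : ℕ[X] → ℕ → ℕ
eval p t = foldr (λ a r → a + t * r) 0 p

-- ℕ[x,y] as ℕ[y][x]: the coefficients of the powers of x are polynomials in y.
ℕ[X,Y] : Set
ℕ[X,Y] = Poly ℕ[X]

infixl 6 _+₂_
_+₂_ : ℕ[X,Y] → ℕ[X,Y] → ℕ[X,Y]
_+₂_ = add (add _+_)

x^_y^_ : ℕ → ℕ → ℕ[X,Y]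
x^ i y^ j = monomial [] (monomial 0 1 j) i

evalY : ℕ[X,Y] → ℕ → ℕ[X]
evalY p t = map (λ q → eval q t) p

-- Only used on non-empty lists.
minimum : List ℕ → ℕ
minimum []       = 0
minimum (k ∷ ks) = min k ks

module _ {n : ℕ} (G : SimpleGraph n) where
  open SimpleGraph G

  neighbours : Fin n → Subset n
  neighbours u = tabulate (λ v → does (adj? u v))

  δ : Subset n → Fin n → ℕ
  δ S u = ∣ S ∩ neighbours u ∣

  -- The truncated subtraction loses nothing: see margin-exact.
  margin : Subset n → Fin n → ℕ
  margin S u = (δ S u + n) ∸ δ (∁ S) u

  margin-exact : ∀ S u → ℤ.+ margin S u ≡ (ℤ.+ δ S u ℤ.- ℤ.+ δ (∁ S) u) ℤ.+ ℤ.+ n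
  margin-exact S u = begin
    ℤ.+ margin S u         ≡⟨ ℤ.⊖-≥ b≤a+n ⟨
    (a + n) ℤ.⊖ b          ≡⟨ ℤ.m-n≡m⊖n (a + n) b ⟨
    a⁺ ℤ.+ n⁺ ℤ.- b⁺       ≡⟨ ℤ.+-assoc a⁺ n⁺ (ℤ.- b⁺) ⟩
    a⁺ ℤ.+ (n⁺ ℤ.- b⁺)     ≡⟨ cong (λ z → a⁺ ℤ.+ z) (ℤ.+-comm n⁺ (ℤ.- b⁺)) ⟩
    a⁺ ℤ.+ (ℤ.- b⁺ ℤ.+ n⁺) ≡⟨ ℤ.+-assoc a⁺ (ℤ.- b⁺) n⁺ ⟨
    a⁺ ℤ.- b⁺ ℤ.+ n⁺       ∎
    where
    open ≡-Reasoning
    a = δ S u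
    b = δ (∁ S) u
    a⁺ = ℤ.+ a
    b⁺ = ℤ.+ b
    n⁺ = ℤ.+ n
    b≤a+n : b ≤ a + n
    b≤a+n = ≤-trans (∣p∣≤n (∁ S ∩ neighbours u)) (m≤n+m n a)

  fy : Subset n → ℕ
  fy S = minimum (map (margin S) (filter (_∈? S) (allFin n)))

  -- The edge relation of G[S].
  InducedAdj : Subset n → Rel (Fin n) 0ℓ
  InducedAdj S u v = u ∈ S × v ∈ S × Adj u v

  -- S is non-empty and any two of its vertices are joined by a walk in G[S].
  Connected : Subset n → Set
  Connected S = Nonempty S × (∀ u v → u ∈ S → v ∈ S → Star (InducedAdj S) u v)

  connected? : ∀ S → Dec (Connected S)
  connected? S = nonempty? S ×-dec
    Fin.all? (λ u → Fin.all? (λ v → (u ∈? S) →-dec ((v ∈? S) →-dec star? u v)))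
    where open Reachability {R = InducedAdj S} (λ u v → (u ∈? S) ×-dec ((v ∈? S) ×-dec adj? u v))

  da : ℕ[X,Y]
  da = foldr _+₂_ [] (map (λ S → x^ ∣ S ∣ y^ fy S) (filter connected? (subsets n)))

  -- Vertex sets of connected components: the maximal connected vertex sets.
  IsComponent : Subset n → Set
  IsComponent C = Connected C × (∀ T → Connected T → C ⊆ T → T ⊆ C)

  isComponent? : ∀ C → Dec (IsComponent C)
  isComponent? C = connected? C ×-dec
    map′ (λ ∄ T cT C⊆T → decidable-stable (T ⊆? C) (λ T⊈C → ∄ (T , cT , (λ {x} → C⊆T {x}) , T⊈C)))
         (λ maximal (T , cT , C⊆T , T⊈C) → T⊈C (maximal T cT C⊆T))
         (¬? (anySubset? (λ T → connected? T ×-dec ((C ⊆? T) ×-dec ¬? (T ⊆? C)))))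

  components : List (Subset n)
  components = filter isComponent? (subsets n)

  IsMaximumComponentOrder : ℕ → Set
  IsMaximumComponentOrder c =
    (∃[ C ] (IsComponent C × ∣ C ∣ ≡ c)) × (∀ C → IsComponent C → ∣ C ∣ ≤ c)

  numComponentsOfOrder : ℕ → ℕ
  numComponentsOfOrder c = length (filter (λ C → ∣ C ∣ ≟ c) components)

{-# OPTIONS --safe #-}

-- At y = 1 every connected vertex set S contributes x^∣S∣, so the coefficient
-- of x^k counts the connected sets of size k. A connected set of the largest
-- size c is maximal under inclusion, hence a component, and conversely every
-- component is connected; so the sets counted by the leading coefficient are
-- exactly the components of order c.
module Submission where

open import Defs
open import Data.Fin using (Fin; zero)
open import Data.Fin.Subset using (Subset; inside; outside; _⊆_; ∣_∣; ⁅_⁆)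
open import Data.Fin.Subset.Properties using (_∈?_; x∈⁅x⁆; x∈⁅y⁆⇒x≡y; p⊂q⇒∣p∣<∣q∣)
open import Data.List using ([]; _∷_; map; foldr; filter; length; upTo; replicate; _++_)
open import Data.List.Membership.Propositional using (_∈_; lose)
open import Data.List.Membership.Propositional.Properties
  using (∈-map⁺; ∈-++⁺ˡ; ∈-++⁺ʳ; ∈-filter⁺; ∈-filter⁻; ∈-upTo⁺)
open import Data.List.Properties
  using (map-++; map-replicate; map-id; filter-some; filter-≐; filter-accept; filter-reject)
open import Data.List.Relation.Unary.All using (lookup)
open import Data.List.Relation.Unary.Any using (here)
open import Data.Nat using (ℕ; zero; suc; _+_; _*_; _^_; _≤_; _<_; z<s; s<s; _≟_; NonZero)
open import Data.Nat.Properties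
  using (≤-totalOrder; ≤⇒≯; n≤0⇒n≡0; n>0⇒n≢0; +-identityʳ; *-zeroʳ; ^-zeroˡ)
open import Data.List.Extrema ≤-totalOrder using (argmax-sel; xs≤max)
open import Data.Nat.Solver using (module +-*-Solver)
open import Data.Product using (_×_; _,_; proj₂; ∃-syntax)
open import Data.Sum using (inj₁; inj₂)
open import Data.Vec using ([]; _∷_)
open import Function using (id; _∘_)
open import Level using (0ℓ)
open import Relation.Binary.Construct.Closure.ReflexiveTransitive using (Star; ε)
open import Relation.Binary.PropositionalEquality
open import Relation.Nullary using (¬?; yes; no; contradiction; _×-dec_)
open import Relation.Unary using (Pred; Decidable)

-- Flattens nested filters into one, so that two of them over `subsets n` can be compared through
-- the equivalence of their predicates.
filter-filter : ∀ {A : Set} {P Q : Pred A 0ℓ} (P? : Decidable P) (Q? : Decidable Q) →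
  ∀ xs → filter P? (filter Q? xs) ≡ filter (λ x → Q? x ×-dec P? x) xs
filter-filter P? Q? []       = refl
filter-filter P? Q? (x ∷ xs) with Q? x
... | no  _ = filter-filter P? Q? xs
... | yes _ with P? x
...   | yes _ = cong (x ∷_) (filter-filter P? Q? xs)
...   | no  _ = filter-filter P? Q? xs

filter-nonempty⇒∃ : ∀ {A : Set} {P : Pred A 0ℓ} (P? : Decidable P) xs →
  length (filter P? xs) ≢ 0 → ∃[ x ] (x ∈ xs × P x)
filter-nonempty⇒∃ P? xs len≢0 with filter P? xs in eq
... | []    = contradiction refl len≢0
... | y ∷ _ = y , ∈-filter⁻ P? (subst (y ∈_) (sym eq) (here refl))

add-identityˡ : ∀ {A : Set} (_⊕_ : A → A → A) q → add _⊕_ [] q ≡ q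
add-identityˡ _⊕_ q = map-id q

-- `alignWith` inspects its first argument before the second, so the left side reduces only after
-- `p` is split.
add-identityʳ : ∀ {A : Set} (_⊕_ : A → A → A) p → add _⊕_ p [] ≡ p
add-identityʳ _⊕_ []        = refl
add-identityʳ _⊕_ p@(_ ∷ _) = map-id p

eval-add : ∀ p q t → eval (add _+_ p q) t ≡ eval p t + eval q t
eval-add []        q       t = cong (λ r → eval r t) (add-identityˡ _+_ q)
eval-add p@(_ ∷ _) []      t =
  trans (cong (λ r → eval r t) (add-identityʳ _+_ p)) (sym (+-identityʳ _))
eval-add (a ∷ p)   (b ∷ q) t = begin
  a + b + t * eval (add _+_ p q) t        ≡⟨ cong (λ r → a + b + t * r) (eval-add p q t) ⟩
  a + b + t * (eval p t + eval q t)       ≡⟨ rearrange a b t (eval p t) (eval q t) ⟩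
  a + t * eval p t + (b + t * eval q t)   ∎
  where
  open ≡-Reasoning
  rearrange : ∀ a b t x y → a + b + t * (x + y) ≡ a + t * x + (b + t * y)
  rearrange = solve 5 (λ a b t x y →
    a :+ b :+ t :* (x :+ y) := a :+ t :* x :+ (b :+ t :* y)) refl
    where open +-*-Solver

eval-monomial : ∀ j t → eval (monomial 0 1 j) t ≡ t ^ j
eval-monomial zero    t = cong suc (*-zeroʳ t)
eval-monomial (suc j) t = cong (t *_) (eval-monomial j t)

-- Addition is coefficientwise in `x`, and `eval-add` handles the coefficients, which are
-- polynomials in `y`. Where one list has ended, its share is the `0` that `coeff` returns there.
coeff-evalY-+₂ : ∀ p q t k →
  coeff (evalY (p +₂ q) t) k ≡ coeff (evalY p t) k + coeff (evalY q t) k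
coeff-evalY-+₂ []        q       t k =
  cong (λ r → coeff (evalY r t) k) (add-identityˡ (add _+_) q)
coeff-evalY-+₂ p@(_ ∷ _) []      t k =
  trans (cong (λ r → coeff (evalY r t) k) (add-identityʳ (add _+_) p)) (sym (+-identityʳ _))
coeff-evalY-+₂ (a ∷ p)   (b ∷ q) t zero    = eval-add a b t
coeff-evalY-+₂ (a ∷ p)   (b ∷ q) t (suc k) = coeff-evalY-+₂ p q t k

coeff-monomial-≡ : ∀ a i → coeff (monomial 0 a i) i ≡ a
coeff-monomial-≡ a zero    = refl
coeff-monomial-≡ a (suc i) = coeff-monomial-≡ a i

coeff-monomial-≢ : ∀ a {i k} → i ≢ k → coeff (monomial 0 a i) k ≡ 0
coeff-monomial-≢ a {zero}  {zero}  i≢k = contradiction refl i≢k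
coeff-monomial-≢ a {zero}  {suc k} i≢k = refl
coeff-monomial-≢ a {suc i} {zero}  i≢k = refl
coeff-monomial-≢ a {suc i} {suc k} i≢k = coeff-monomial-≢ a (i≢k ∘ cong suc)

evalY-monomial : ∀ i j → evalY (x^ i y^ j) 1 ≡ monomial 0 1 i
evalY-monomial i j = begin
  map (λ q → eval q 1) (monomial [] y^j i)  ≡⟨ map-++ _ (replicate i []) _ ⟩
  -- The padding coefficients `[]` evaluate to `0`, and the leading one to `1 ^ j`, that is, to `1`.
  map _ (replicate i []) ++ eval y^j 1 ∷ [] ≡⟨ cong₂ (λ zs a → zs ++ a ∷ []) (map-replicate _ i []) y^j[1]≡1 ⟩
  monomial 0 1 i                            ∎
  where
  open ≡-Reasoning
  y^j = monomial 0 1 j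
  y^j[1]≡1 : eval y^j 1 ≡ 1
  y^j[1]≡1 = trans (eval-monomial j 1) (^-zeroˡ j)

coeff-sum-of-monomials : ∀ {A : Set} (i j : A → ℕ) xs k →
  coeff (evalY (foldr _+₂_ [] (map (λ s → x^ i s y^ j s) xs)) 1) k
    ≡ length (filter (λ s → i s ≟ k) xs)
coeff-sum-of-monomials i j []       k = refl
coeff-sum-of-monomials i j (s ∷ xs) k = begin
  coeff (evalY (m +₂ p) 1) k                        ≡⟨ coeff-evalY-+₂ m p 1 k ⟩
  coeff (evalY m 1) k + coeff (evalY p 1) k         ≡⟨ cong₂ (λ q r → coeff q k + r) (evalY-monomial (i s) (j s)) (coeff-sum-of-monomials i j xs k) ⟩
  coeff (monomial 0 1 (i s)) k + length (count xs)  ≡⟨ step ⟩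
  length (count (s ∷ xs))                           ∎
  where
  open ≡-Reasoning
  m = x^ i s y^ j s
  p = foldr _+₂_ [] (map (λ s → x^ i s y^ j s) xs)
  count = filter (λ s → i s ≟ k)
  step : coeff (monomial 0 1 (i s)) k + length (count xs) ≡ length (count (s ∷ xs))
  -- The monomial adds one to the coefficient exactly when the filter keeps `s`.
  step with i s ≟ k
  ... | yes refl = trans (cong (_+ length (count xs)) (coeff-monomial-≡ 1 (i s)))
                         (cong length (sym (filter-accept (λ s → i s ≟ k) refl)))
  ... | no  is≢k = trans (cong (_+ length (count xs)) (coeff-monomial-≢ 1 is≢k))
                         (cong length (sym (filter-reject (λ s → i s ≟ k) is≢k)))

-- Ensures that the search range `upTo (length p)` in `deg` misses no exponent with a nonzero
-- coefficient.
coeff≢0⇒<length : ∀ p {k} → coeff p k ≢ 0 → k < length p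
coeff≢0⇒<length []              c≢0 = contradiction refl c≢0
coeff≢0⇒<length (a ∷ p) {zero}  c≢0 = z<s
coeff≢0⇒<length (a ∷ p) {suc k} c≢0 = s<s (coeff≢0⇒<length p c≢0)

coeff≢0⇒≤deg : ∀ p {k} → coeff p k ≢ 0 → k ≤ deg p
coeff≢0⇒≤deg p c≢0 = lookup (xs≤max 0 _)
  (∈-filter⁺ (λ k → ¬? (coeff p k ≟ 0)) (∈-upTo⁺ (coeff≢0⇒<length p c≢0)) c≢0)

-- The hypothesis excludes the zero polynomial, whose degree is the junk value 0.
coeff-deg≢0 : ∀ p {k} → coeff p k ≢ 0 → coeff p (deg p) ≢ 0
coeff-deg≢0 p {k} c≢0 with argmax-sel id 0 (filter (λ k → ¬? (coeff p k ≟ 0)) (upTo (length p)))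
... | inj₂ deg∈  = proj₂ (∈-filter⁻ (λ k → ¬? (coeff p k ≟ 0)) {xs = upTo (length p)} deg∈)
-- The maximum may be the default `0` given to `max`. Then `k ≤ deg p` forces `k` to be `0`, so the
-- given nonzero coefficient is the one at the degree.
... | inj₁ deg≡0 = subst (λ d → coeff p d ≢ 0) (trans k≡0 (sym deg≡0)) c≢0
  where
  k≡0 : k ≡ 0
  k≡0 = n≤0⇒n≡0 (subst (k ≤_) deg≡0 (coeff≢0⇒≤deg p c≢0))

∈-subsets : ∀ {n} (S : Subset n) → S ∈ subsets n
∈-subsets []            = here refl
∈-subsets (inside  ∷ S) = ∈-++⁺ˡ (∈-map⁺ (inside ∷_) (∈-subsets S))
∈-subsets (outside ∷ S) = ∈-++⁺ʳ (map (inside ∷_) (subsets _)) (∈-map⁺ (outside ∷_) (∈-subsets S))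

-- An element of `q` outside `p` would make the inclusion strict and `q` larger. This converts a
-- bound on sizes into maximality under inclusion.
⊆∧∣≥∣⇒⊇ : ∀ {n} {p q : Subset n} → p ⊆ q → ∣ q ∣ ≤ ∣ p ∣ → q ⊆ p
⊆∧∣≥∣⇒⊇ {p = p} p⊆q ∣q∣≤∣p∣ {x} x∈q with x ∈? p
... | yes x∈p = x∈p
... | no  x∉p = contradiction (p⊂q⇒∣p∣<∣q∣ (p⊆q , x , x∈q , x∉p)) (≤⇒≯ ∣q∣≤∣p∣)

module _ {n : ℕ} (G : SimpleGraph n) where

  -- Guarantees that `evalY (da G) 1` is nonzero as soon as there is a vertex. The empty walk
  -- suffices, both endpoints being `v`.
  connected-⁅⁆ : ∀ v → Connected G ⁅ v ⁆
  connected-⁅⁆ v = (v , x∈⁅x⁆ v) , λ u w u∈ w∈ →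
    subst (Star _ u) (trans (x∈⁅y⁆⇒x≡y v u∈) (sym (x∈⁅y⁆⇒x≡y v w∈))) ε

  coeff-da : ∀ k → coeff (evalY (da G) 1) k
    ≡ length (filter (λ S → ∣ S ∣ ≟ k) (filter (connected? G) (subsets n)))
  coeff-da = coeff-sum-of-monomials ∣_∣ (fy G) (filter (connected? G) (subsets n))

  -- The coefficient is a count, and `S` itself is among the sets counted.
  connected⇒coeff≢0 : ∀ {S} → Connected G S → coeff (evalY (da G) 1) ∣ S ∣ ≢ 0
  connected⇒coeff≢0 {S} cS = subst (_≢ 0) (sym (coeff-da ∣ S ∣))
    (n>0⇒n≢0 (filter-some (λ T → ∣ T ∣ ≟ ∣ S ∣)
      (lose (∈-filter⁺ (connected? G) (∈-subsets S) cS) refl)))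

  coeff≢0⇒connected : ∀ {k} → coeff (evalY (da G) 1) k ≢ 0 → ∃[ S ] (Connected G S × ∣ S ∣ ≡ k)
  coeff≢0⇒connected {k} c≢0
    with filter-nonempty⇒∃ (λ S → ∣ S ∣ ≟ k) (filter (connected? G) (subsets n))
           (subst (_≢ 0) (coeff-da k) c≢0)
  ... | S , S∈ , ∣S∣≡k = S , proj₂ (∈-filter⁻ (connected? G) {xs = subsets n} S∈) , ∣S∣≡k

  maximumConnected⇒component : ∀ {c} → (∀ {T} → Connected G T → ∣ T ∣ ≤ c) →
    ∀ {S} → Connected G S → ∣ S ∣ ≡ c → IsComponent G S
  maximumConnected⇒component bound cS ∣S∣≡c =
    cS , λ T cT S⊆T → ⊆∧∣≥∣⇒⊇ S⊆T (subst (∣ T ∣ ≤_) (sym ∣S∣≡c) (bound cT))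

  numComponents-maximum : ∀ {c} → (∀ {T} → Connected G T → ∣ T ∣ ≤ c) →
    numComponentsOfOrder G c ≡ coeff (evalY (da G) 1) c
  numComponents-maximum {c} bound = trans (cong length same) (sym (coeff-da c))
    where
    order-c? : Decidable (λ S → ∣ S ∣ ≡ c)
    order-c? S = ∣ S ∣ ≟ c

    same : filter order-c? (components G) ≡ filter order-c? (filter (connected? G) (subsets n))
    same = begin
      filter order-c? (filter (isComponent? G) (subsets n))
        ≡⟨ filter-filter order-c? (isComponent? G) (subsets n) ⟩
      filter (λ S → isComponent? G S ×-dec order-c? S) (subsets n)
        ≡⟨ filter-≐ (λ S → isComponent? G S ×-dec order-c? S) (λ S → connected? G S ×-dec order-c? S)
             ( (λ ((cS , _) , ∣S∣≡c) → cS , ∣S∣≡c)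
             -- Maximality, dropped in the forward direction, is recovered here from `bound` and the
             -- order `c`.
             , (λ (cS , ∣S∣≡c) → maximumConnected⇒component bound cS ∣S∣≡c , ∣S∣≡c)) (subsets n) ⟩
      filter (λ S → connected? G S ×-dec order-c? S) (subsets n)
        ≡⟨ filter-filter order-c? (connected? G) (subsets n) ⟨
      filter order-c? (filter (connected? G) (subsets n))
        ∎
      where open ≡-Reasoning

  order≤deg : ∀ {S} → Connected G S → ∣ S ∣ ≤ deg (evalY (da G) 1)
  order≤deg cS = coeff≢0⇒≤deg (evalY (da G) 1) (connected⇒coeff≢0 cS)

  deg-isMaximumComponentOrder : Fin n → IsMaximumComponentOrder G (deg (evalY (da G) 1))
  deg-isMaximumComponentOrder v = largest , λ C (cC , _) → order≤deg cC
    where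
    largest : ∃[ C ] (IsComponent G C × ∣ C ∣ ≡ deg (evalY (da G) 1))
    largest =
      -- The singleton of `v` yields some nonzero coefficient, hence the one at the degree is
      -- nonzero and counts a connected set.
      let S , cS , ∣S∣≡c = coeff≢0⇒connected
            (coeff-deg≢0 (evalY (da G) 1) (connected⇒coeff≢0 (connected-⁅⁆ v)))
      in S , maximumConnected⇒component order≤deg cS ∣S∣≡c , ∣S∣≡c

proposition13 : ∀ (n : ℕ) .{{_ : NonZero n}} (G : SimpleGraph n) →
    let p = evalY (da G) 1
        c = deg p
    in IsMaximumComponentOrder G c × numComponentsOfOrder G c ≡ coeff p c
-- A nonzero `n` is a successor, which provides the vertex `zero`.
proposition13 (suc m) G =
  deg-isMaximumComponentOrder G zero , numComponents-maximum G (order≤deg G)
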